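{- Define the formal power series (tail sums) $H_3:=T$, $H_2:=B+T$, $H_1:=A+B+T$, $H_0:=F+A+B+T=G$, and the map $$\Phi_x(u):=u+\frac{x}{1-u}$$ on formal power series $u=u(x)$ with zero constant term. Then $$H_2(x)=\Phi_x(H_3(x)),\qquad H_1(x)=\Phi_x(H_2(x)),\qquad H_0(x)=\Phi_x(H_1(x)).$$ Equivalently, $G(x)=\Phi_x^{\,3}(T(x))$, where $\Phi_x^{\,3}$ denotes the threefold iterate of $\Phi_x$.
   Context: Let $V_4=\{0<a<b<1\}$ be a four-element chain with Gödel implication $x\Rightarrow_G y=1$ if $x\le y$ and $x\Rightarrow_G y=y$ if $x>y$. For $n\ge1$, consider the $C_{n-1}$ full bracketings of $p_1\Rightarrow_G p_2\Rightarrow_G\cdots\Rightarrow_G p_n$ in $n$ distinct variables (equivalently, full binary trees with $n$ ordered leaves $p_1,\dots,p_n$), where $C_k$ is the $k$-th Catalan number. Let $f_n,a_n,b_n,t_n$ be the number of pairs (bracketing, valuation $\{p_1,\dots,p_n\}\to V_4$) for which the bracketed formula evaluates to $0,a,b,1$ respectively, and let $g_n=f_n+a_n+b_n+t_n=4^nC_{n-1}$. Put $F(x)=\sum_{n\ge1}f_nx^n$, $A(x)=\sum_{n\ge1}a_nx^n$, $B(x)=\sum_{n\ge1}b_nx^n$, $T(x)=\sum_{n\ge1}t_nx^n$, $G(x)=\sum_{n\ge1}g_nx^n$ (formal power series). -}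

module Defs where

open import Data.Bool.Base using (if_then_else_)
open import Data.Empty using (⊥)
open import Data.Fin.Base using (Fin; zero; suc)
open import Data.Fin.Properties using (_≟_; _≤?_)
open import Data.Integer.Base as ℤ using (ℤ; 0ℤ; 1ℤ; +_)
import Data.Integer.Properties as ℤ
open import Data.Integer.Tactic.RingSolver using (solve-∀)
open import Data.List.Base
  using (List; []; _∷_; _++_; map; concatMap; foldr; applyUpTo; filter; length;
         cartesianProduct; cartesianProductWith; allFin)
open import Data.List.Membership.Propositional using (_∈_)
open import Data.List.Membership.Propositional.Properties
  using (∈-++⁺ˡ; ∈-++⁺ʳ; ∈-map⁺; ∈-concatMap⁺; ∈-concatMap⁻; ∈-allFin;
         ∈-cartesianProduct⁺; ∈-cartesianProductWith⁺; ∈-cartesianProductWith⁻)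
open import Data.List.Properties using (map-cong; map-∘)
open import Data.List.Relation.Binary.Disjoint.Propositional using (Disjoint)
open import Data.List.Relation.Unary.All as All using (All)
import Data.List.Relation.Unary.All.Properties as All
open import Data.List.Relation.Unary.AllPairs as AllPairs using (AllPairs; []; _∷_)
import Data.List.Relation.Unary.AllPairs.Properties as AllPairs
open import Data.List.Relation.Unary.Any as Any using (here; there)
open import Data.List.Relation.Unary.Unique.Propositional using (Unique)
import Data.List.Relation.Unary.Unique.Propositional.Properties as Unique
open import Data.Maybe.Base using (Maybe; just; nothing)
open import Data.Maybe.Properties using (just-injective)
open import Data.Nat.Base as ℕ using (ℕ; zero; suc; z≤n; s≤s)
import Data.Nat.Properties as ℕ
open import Data.Product.Base using (_×_; _,_; proj₁; proj₂; ∃; ∃₂)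
open import Data.Vec.Base using (Vec; []; _∷_; head; take; drop)
import Data.Vec.Properties as Vec
open import Relation.Binary.PropositionalEquality
  using (_≡_; _≢_; refl; sym; trans; cong; cong₂; _≗_; module ≡-Reasoning)
open import Relation.Nullary.Decidable.Core using (⌊_⌋)

------------------------------------------------------------------------
-- The Gödel chain

V₄ : Set
V₄ = Fin 4

pattern 𝟎 = zero
pattern 𝒂 = suc zero
pattern 𝒃 = suc (suc zero)
pattern 𝟏 = suc (suc (suc zero))

infixr 5 _⇒G_

_⇒G_ : V₄ → V₄ → V₄
x ⇒G y = if ⌊ x ≤? y ⌋ then 𝟏 else y

------------------------------------------------------------------------
-- Bracketings and their evaluation

infixr 5 _⇒_

-- The index is the number of leaves; the leaves, read from left to right,
-- are the variables p₁, …, pₙ.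
data Bracketing : ℕ → Set where
  leaf : Bracketing 1
  _⇒_  : ∀ {m n} → Bracketing m → Bracketing n → Bracketing (m ℕ.+ n)

Valuation : ℕ → Set
Valuation n = Vec V₄ n

eval : ∀ {n} → Bracketing n → Valuation n → V₄
eval leaf            ν = head ν
eval (_⇒_ {m} s t) ν = eval s (take m ν) ⇒G eval t (drop m ν)

------------------------------------------------------------------------
-- Enumeration and counting

Split : ℕ → Set
Split n = ∃₂ λ i j → i ℕ.+ j ≡ n

sucˡ : ∀ {n} → Split n → Split (suc n)
sucˡ (i , j , e) = suc i , j , cong suc e

splits : ∀ n → List (Split n)
splits zero    = (0 , 0 , refl) ∷ []
splits (suc n) = (0 , suc n , refl) ∷ map sucˡ (splits n)

leaves : ∀ n → List (Bracketing n)
leaves 1 = leaf ∷ []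
leaves _ = []

combine : (∀ k → List (Bracketing k)) → ∀ {n} → Split n → List (Bracketing n)
combine bs (i , j , refl) = cartesianProductWith _⇒_ (bs i) (bs j)

-- The first argument bounds the number of nodes on a branch.  A bracketing
-- with n leaves never exceeds n.
bracketings≤ : ℕ → ∀ n → List (Bracketing n)
bracketings≤ zero    n = []
bracketings≤ (suc d) n = leaves n ++ concatMap (combine (bracketings≤ d)) (splits n)

bracketings : ∀ n → List (Bracketing n)
bracketings n = bracketings≤ n n

valuations : ∀ n → List (Valuation n)
valuations zero    = [] ∷ []
valuations (suc n) = cartesianProductWith _∷_ (allFin 4) (valuations n)

interpretations : ∀ n → List (Bracketing n × Valuation n)
interpretations n = cartesianProduct (bracketings n) (valuations n)

#value : V₄ → ℕ → ℕ
#value v n = length (filter (λ (s , ν) → eval s ν ≟ v) (interpretations n))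

f a b t g : ℕ → ℕ
f = #value 𝟎
a = #value 𝒂
b = #value 𝒃
t = #value 𝟏
g n = f n ℕ.+ a n ℕ.+ b n ℕ.+ t n

------------------------------------------------------------------------
-- `interpretations n` lists every (bracketing, valuation) exactly once

∈-splits : ∀ {n} (s : Split n) → s ∈ splits n
∈-splits (zero  , zero  , refl) = here refl
∈-splits (zero  , suc j , refl) = here refl
∈-splits (suc i , j     , refl) = there (∈-map⁺ sucˡ (∈-splits (i , j , refl)))

size>0 : ∀ {n} → Bracketing n → 1 ℕ.≤ n
size>0 leaf              = s≤s z≤n
size>0 (_⇒_ {m} {n} s _) = ℕ.≤-trans (size>0 s) (ℕ.m≤m+n m n)

∈-bracketings≤ : ∀ {d n} (s : Bracketing n) → n ℕ.≤ d → s ∈ bracketings≤ d n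
∈-bracketings≤ {suc d} leaf _ = here refl
∈-bracketings≤ {zero} (s ⇒ s′) le with ℕ.≤-trans (size>0 (s ⇒ s′)) le
... | ()
∈-bracketings≤ {suc d} (_⇒_ {i} {j} s s′) le =
  ∈-++⁺ʳ (leaves (i ℕ.+ j))
    (∈-concatMap⁺ (combine (bracketings≤ d))
      (Any.map (λ where refl → ∈-cartesianProductWith⁺ _⇒_
                                 (∈-bracketings≤ s i≤d) (∈-bracketings≤ s′ j≤d))
               (∈-splits (i , j , refl))))
  where
  i≤d : i ℕ.≤ d
  i≤d = ℕ.≤-pred (ℕ.≤-trans (ℕ.m<m+n i (size>0 s′)) le)
  j≤d : j ℕ.≤ d
  j≤d = ℕ.≤-pred (ℕ.≤-trans (ℕ.m<n+m j (size>0 s)) le)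

∈-bracketings : ∀ {n} (s : Bracketing n) → s ∈ bracketings n
∈-bracketings s = ∈-bracketings≤ s ℕ.≤-refl

∈-valuations : ∀ {n} (ν : Valuation n) → ν ∈ valuations n
∈-valuations []      = here refl
∈-valuations (x ∷ ν) = ∈-cartesianProductWith⁺ _∷_ (∈-allFin x) (∈-valuations ν)

∈-interpretations : ∀ {n} (p : Bracketing n × Valuation n) → p ∈ interpretations n
∈-interpretations (s , ν) = ∈-cartesianProduct⁺ (∈-bracketings s) (∈-valuations ν)

splits-distinct : ∀ n → AllPairs (λ (s s′ : Split n) → proj₁ s ≢ proj₁ s′) (splits n)
splits-distinct zero    = All.[] ∷ []
splits-distinct (suc n) =
  All.map⁺ (All.universal (λ _ ()) (splits n)) ∷
  AllPairs.map⁺ (AllPairs.map (λ ne e → ne (ℕ.suc-injective e)) (splits-distinct n))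

leftSize : ∀ {n} → Bracketing n → Maybe ℕ
leftSize leaf        = nothing
leftSize (_⇒_ {m} _ _) = just m

leftSize-combine : ∀ bs {n} (p : Split n) {s} → s ∈ combine bs p →
                   leftSize s ≡ just (proj₁ p)
leftSize-combine bs (i , j , refl) s∈
  with ∈-cartesianProductWith⁻ _⇒_ (bs i) (bs j) s∈
... | _ , _ , _ , _ , refl = refl

leftSize-leaves : ∀ n {s : Bracketing n} → s ∈ leaves n → leftSize s ≡ nothing
leftSize-leaves 1 (here refl) = refl

⇒-injective : ∀ {m n} {r r′ : Bracketing m} {s s′ : Bracketing n} →
              r ⇒ s ≡ r′ ⇒ s′ → r ≡ r′ × s ≡ s′
⇒-injective refl = refl , refl

leaves-unique : ∀ n → Unique (leaves n)
leaves-unique 0             = []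
leaves-unique 1             = All.[] ∷ []
leaves-unique (suc (suc _)) = []

bracketings≤-unique : ∀ d n → Unique (bracketings≤ d n)
bracketings≤-unique zero    n = []
bracketings≤-unique (suc d) n =
  Unique.++⁺ (leaves-unique n)
    (Unique.concat⁺
      (All.map⁺ (All.universal combine-unique (splits n)))
      (AllPairs.map⁺ (AllPairs.map (λ {p} {q} → combine-disjoint {p} {q}) (splits-distinct n))))
    λ (s∈l , s∈c) → disjoint s∈l (Any.satisfied (∈-concatMap⁻ (combine bs) {xs = splits n} s∈c))
  where
  bs : ∀ k → List (Bracketing k)
  bs = bracketings≤ d
  combine-unique : ∀ p → Unique (combine bs {n} p)
  combine-unique (i , j , refl) =
    Unique.cartesianProductWith⁺ _⇒_ ⇒-injective
      (bracketings≤-unique d i) (bracketings≤-unique d j)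
  combine-disjoint : ∀ {p q} → proj₁ p ≢ proj₁ q → Disjoint (combine bs {n} p) (combine bs q)
  combine-disjoint {p} {q} ne (s∈p , s∈q) =
    ne (just-injective (trans (sym (leftSize-combine bs p s∈p)) (leftSize-combine bs q s∈q)))
  disjoint : ∀ {s} → s ∈ leaves n → ∃ (λ p → s ∈ combine bs p) → ⊥
  disjoint s∈l (p , s∈p)
    with trans (sym (leftSize-leaves n s∈l)) (leftSize-combine bs p s∈p)
  ... | ()

valuations-unique : ∀ n → Unique (valuations n)
valuations-unique zero    = All.[] ∷ []
valuations-unique (suc n) =
  Unique.cartesianProductWith⁺ _∷_ Vec.∷-injective (Unique.allFin⁺ 4) (valuations-unique n)

interpretations-unique : ∀ n → Unique (interpretations n)
interpretations-unique n =
  Unique.cartesianProduct⁺ (bracketings≤-unique n n) (valuations-unique n)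

------------------------------------------------------------------------
-- Formal power series over ℤ

PowerSeries : Set
PowerSeries = ℕ → ℤ

∑ : List ℤ → ℤ
∑ = foldr ℤ._+_ 0ℤ

infixl 6 _⊕_ _⊖_
infixl 7 _⊛_
infixr 8 _^_

_⊕_ _⊖_ _⊛_ : PowerSeries → PowerSeries → PowerSeries
(u ⊕ v) n = u n ℤ.+ v n
(u ⊖ v) n = u n ℤ.- v n
(u ⊛ v) n = ∑ (map (λ (i , j , _) → u i ℤ.* v j) (splits n))

one x : PowerSeries
one zero    = 1ℤ
one (suc _) = 0ℤ
x 1 = 1ℤ
x _ = 0ℤ

_^_ : PowerSeries → ℕ → PowerSeries
u ^ zero  = one
u ^ suc k = u ⊛ u ^ k

-- 1/(1 - u) = ∑ₖ uᵏ, where for u with zero constant term only the powers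
-- k ≤ n contribute to the coefficient of xⁿ.
1/1-_ : PowerSeries → PowerSeries
(1/1- u) n = ∑ (applyUpTo (λ k → (u ^ k) n) (suc n))

------------------------------------------------------------------------
-- Under a zero constant term, `1/1- u` is the inverse of `one ⊖ u`

∑-map-+ : ∀ {A : Set} (h k : A → ℤ) xs →
          ∑ (map (λ y → h y ℤ.+ k y) xs) ≡ ∑ (map h xs) ℤ.+ ∑ (map k xs)
∑-map-+ h k []       = refl
∑-map-+ h k (y ∷ ys) =
  trans (cong (ℤ._+_ (h y ℤ.+ k y)) (∑-map-+ h k ys)) (lemma (h y) (k y) _ _)
  where
  lemma : ∀ p q r s → (p ℤ.+ q) ℤ.+ (r ℤ.+ s) ≡ (p ℤ.+ r) ℤ.+ (q ℤ.+ s)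
  lemma = solve-∀

∑-map-0 : ∀ {A : Set} (h : A → ℤ) xs → (∀ y → h y ≡ 0ℤ) → ∑ (map h xs) ≡ 0ℤ
∑-map-0 h []       h≡0 = refl
∑-map-0 h (y ∷ ys) h≡0 = cong₂ ℤ._+_ (h≡0 y) (∑-map-0 h ys h≡0)

∑-applyUpTo-cong : ∀ {h k : ℕ → ℤ} → h ≗ k → ∀ N → ∑ (applyUpTo h N) ≡ ∑ (applyUpTo k N)
∑-applyUpTo-cong h≗k zero    = refl
∑-applyUpTo-cong h≗k (suc N) = cong₂ ℤ._+_ (h≗k 0) (∑-applyUpTo-cong (λ i → h≗k (suc i)) N)

∑-applyUpTo-* : ∀ c h N → c ℤ.* ∑ (applyUpTo h N) ≡ ∑ (applyUpTo (λ k → c ℤ.* h k) N)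
∑-applyUpTo-* c h zero    = ℤ.*-zeroʳ c
∑-applyUpTo-* c h (suc N) =
  trans (ℤ.*-distribˡ-+ c _ _) (cong (ℤ._+_ (c ℤ.* h 0)) (∑-applyUpTo-* c (λ k → h (suc k)) N))

∑-swap : ∀ {A : Set} (h : ℕ → A → ℤ) xs N →
         ∑ (map (λ y → ∑ (applyUpTo (λ k → h k y) N)) xs) ≡
         ∑ (applyUpTo (λ k → ∑ (map (h k) xs)) N)
∑-swap h xs zero    = ∑-map-0 _ xs (λ _ → refl)
∑-swap h xs (suc N) =
  trans (∑-map-+ (h 0) _ xs) (cong (ℤ._+_ (∑ (map (h 0) xs))) (∑-swap (λ k → h (suc k)) xs N))

∑-truncate : ∀ {M N} (h : ℕ → ℤ) → M ℕ.≤ N → (∀ k → M ℕ.≤ k → h k ≡ 0ℤ) →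
             ∑ (applyUpTo h N) ≡ ∑ (applyUpTo h M)
∑-truncate {N = zero}  h z≤n     h≡0 = refl
∑-truncate {N = suc N} h z≤n     h≡0 =
  cong₂ ℤ._+_ (h≡0 0 z≤n) (∑-truncate {N = N} (λ k → h (suc k)) z≤n (λ k _ → h≡0 (suc k) z≤n))
∑-truncate h (s≤s M≤N) h≡0 =
  cong (ℤ._+_ (h 0)) (∑-truncate (λ k → h (suc k)) M≤N (λ k M≤k → h≡0 (suc k) (s≤s M≤k)))

∑-telescope : ∀ h N → ∑ (applyUpTo (λ k → h k ℤ.- h (suc k)) N) ≡ h 0 ℤ.- h N
∑-telescope h zero    = sym (ℤ.+-inverseʳ (h 0))
∑-telescope h (suc N) =
  trans (cong (ℤ._+_ (h 0 ℤ.- h 1)) (∑-telescope (λ k → h (suc k)) N)) (lemma (h 0) (h 1) _)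
  where
  lemma : ∀ p q r → (p ℤ.- q) ℤ.+ (q ℤ.- r) ≡ p ℤ.- r
  lemma = solve-∀

^-vanishes : ∀ u → u 0 ≡ 0ℤ → ∀ k n → n ℕ.< k → (u ^ k) n ≡ 0ℤ
^-vanishes u u₀ (suc k) n (s≤s n≤k) = ∑-map-0 _ (splits n) term
  where
  term : ∀ (s : Split n) → u (proj₁ s) ℤ.* (u ^ k) (proj₁ (proj₂ s)) ≡ 0ℤ
  term (zero  , j , _)    rewrite u₀ = ℤ.*-zeroˡ ((u ^ k) j)
  term (suc i , j , refl)
    rewrite ^-vanishes u u₀ k j (ℕ.≤-trans (s≤s (ℕ.m≤n+m j i)) n≤k) = ℤ.*-zeroʳ (u (suc i))

one-⊛ : ∀ u → one ⊛ u ≗ u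
one-⊛ u zero    = trans (ℤ.+-identityʳ _) (ℤ.*-identityˡ (u 0))
one-⊛ u (suc n) = begin
  1ℤ ℤ.* u (suc n) ℤ.+ ∑ (map _ (map sucˡ (splits n)))
    ≡⟨ cong₂ ℤ._+_ (ℤ.*-identityˡ (u (suc n)))
         (trans (cong ∑ (sym (map-∘ (splits n))))
                (∑-map-0 _ (splits n) (λ (_ , j , _) → ℤ.*-zeroˡ (u j)))) ⟩
  u (suc n) ℤ.+ 0ℤ
    ≡⟨ ℤ.+-identityʳ _ ⟩
  u (suc n) ∎
  where open ≡-Reasoning

⊛-distribʳ-⊖ : ∀ u v w → (u ⊖ v) ⊛ w ≗ (u ⊛ w) ⊖ (v ⊛ w)
⊛-distribʳ-⊖ u v w n = go (splits n)
  where
  lemma : ∀ p q r s t → (p ℤ.- q) ℤ.* r ℤ.+ (s ℤ.- t) ≡ (p ℤ.* r ℤ.+ s) ℤ.- (q ℤ.* r ℤ.+ t)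
  lemma = solve-∀
  go : ∀ (ss : List (Split n)) →
       ∑ (map (λ (i , j , _) → (u i ℤ.- v i) ℤ.* w j) ss) ≡
       ∑ (map (λ (i , j , _) → u i ℤ.* w j) ss) ℤ.- ∑ (map (λ (i , j , _) → v i ℤ.* w j) ss)
  go []                 = refl
  go ((i , j , _) ∷ ss) =
    trans (cong (ℤ._+_ ((u i ℤ.- v i) ℤ.* w j)) (go ss)) (lemma (u i) (v i) (w j) _ _)

1/1--inverse : ∀ u → u 0 ≡ 0ℤ → (one ⊖ u) ⊛ (1/1- u) ≗ one
1/1--inverse u u₀ n = begin
  ∑ (map (λ (i , j , _) → c i ℤ.* (1/1- u) j) (splits n))
    ≡⟨ cong ∑ (map-cong extend (splits n)) ⟩
  ∑ (map (λ (i , j , _) → ∑ (applyUpTo (λ k → c i ℤ.* (u ^ k) j) (suc n))) (splits n))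
    ≡⟨ ∑-swap (λ k (i , j , _) → c i ℤ.* (u ^ k) j) (splits n) (suc n) ⟩
  ∑ (applyUpTo (λ k → (c ⊛ u ^ k) n) (suc n))
    ≡⟨ ∑-applyUpTo-cong (λ k → trans (⊛-distribʳ-⊖ one u (u ^ k) n)
         (cong (ℤ._- (u ^ suc k) n) (one-⊛ (u ^ k) n))) (suc n) ⟩
  ∑ (applyUpTo (λ k → (u ^ k) n ℤ.- (u ^ suc k) n) (suc n))
    ≡⟨ ∑-telescope (λ k → (u ^ k) n) (suc n) ⟩
  one n ℤ.- (u ^ suc n) n
    ≡⟨ cong (λ z → one n ℤ.- z) (^-vanishes u u₀ (suc n) n ℕ.≤-refl) ⟩
  one n ℤ.- 0ℤ
    ≡⟨ ℤ.+-identityʳ (one n) ⟩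
  one n ∎
  where
  open ≡-Reasoning
  c : PowerSeries
  c = one ⊖ u
  extend : ∀ (s : Split n) → c (proj₁ s) ℤ.* (1/1- u) (proj₁ (proj₂ s)) ≡
           ∑ (applyUpTo (λ k → c (proj₁ s) ℤ.* (u ^ k) (proj₁ (proj₂ s))) (suc n))
  extend (i , j , refl) = trans
    (cong (c i ℤ.*_) (sym (∑-truncate (λ k → (u ^ k) j) (s≤s (ℕ.m≤n+m j i))
                            (λ k j<k → ^-vanishes u u₀ k j j<k))))
    (∑-applyUpTo-* (c i) (λ k → (u ^ k) j) (suc n))

------------------------------------------------------------------------
-- Series with zero constant term, and the map Φₓ

record Series₀ : Set where
  constructor series₀
  field
    coeff   : PowerSeries
    coeff-0 : coeff 0 ≡ 0ℤ
open Series₀ public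

infix 4 _≈_
_≈_ : Series₀ → Series₀ → Set
u ≈ v = coeff u ≗ coeff v

infixl 6 _+_
_+_ : Series₀ → Series₀ → Series₀
series₀ u u₀ + series₀ v v₀ = series₀ (u ⊕ v) (cong₂ ℤ._+_ u₀ v₀)

Φ : Series₀ → Series₀
Φ (series₀ u u₀) = series₀ (u ⊕ x ⊛ (1/1- u)) (cong (ℤ._+ 0ℤ) u₀)

------------------------------------------------------------------------
-- The generating functions and their tail sums

-- The index in ∑_{n ≥ 1} starts at 1, and the counts vanish at n = 0.
genFun : (c : ℕ → ℕ) → c 0 ≡ 0 → Series₀
genFun c c₀ = series₀ (λ n → + c n) (cong (λ k → + k) c₀)

F A B T G : Series₀
F = genFun f refl
A = genFun a refl
B = genFun b refl
T = genFun t refl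
G = genFun g refl

H₀ H₁ H₂ H₃ : Series₀
H₀ = F + A + B + T
H₁ = A + B + T
H₂ = B + T
H₃ = T

{-# OPTIONS --safe #-}

-- Weight every pair (bracketing, valuation) by φ (value of the formula) and
-- let W φ be the resulting generating function.  If φ sums to 1 over V₄ and
-- φ (p ⇒G q) factors as χ p · φ q, splitting a bracketing at its root gives
-- W φ = x + W χ · W φ, so W φ = x / (1 - W χ).  For a truth value v ≠ 1 the
-- formula p ⇒ q has value v exactly when q = v and p > v, so the indicator of v factors in this way, χ
-- being the indicator of the values above v.  Hence the generating function of
-- v is x / (1 - u), with u the tail sum above v.
module Submission where

open import Defs
open import Data.Bool.Base using (if_then_else_; true; false)
open import Data.Fin.Properties using (_≟_; all?)
open import Data.Integer.Base as ℤ using (ℤ; 0ℤ; 1ℤ; +_)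
import Data.Integer.Properties as ℤ
open import Data.Integer.Tactic.RingSolver using (solve-∀)
open import Data.List.Base
  using (List; []; _∷_; _++_; map; concatMap; filter; length; cartesianProductWith; allFin)
open import Data.List.Properties
  using (map-cong; map-∘; map-++; concatMap-cong; cartesianProductWith-zeroʳ)
open import Data.Nat.Base as ℕ using (ℕ; zero; suc; z≤n; s≤s)
open import Data.Nat.GeneralisedArithmetic using (iterate)
open import Data.Nat.Induction using (<-rec)
import Data.Nat.Properties as ℕ
open import Data.Product.Base using (_×_; _,_)
open import Data.Vec.Base using (_∷_; []; take; drop)
open import Function.Base using (_∘_)
open import Level using (0ℓ)
open import Relation.Binary.PropositionalEquality
  using (_≡_; refl; sym; trans; cong; cong₂; _≗_; module ≡-Reasoning)
open import Relation.Nullary.Decidable.Core using (does; from-yes)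
open import Relation.Unary using (Pred; Decidable)

open ≡-Reasoning

private
  variable
    X Y Z : Set

-- Finite sums

∑-cong : {h k : X → ℤ} → h ≗ k → ∀ xs → ∑ (map h xs) ≡ ∑ (map k xs)
∑-cong h≗k xs = cong ∑ (map-cong h≗k xs)

∑-++ : ∀ us vs → ∑ (us ++ vs) ≡ ∑ us ℤ.+ ∑ vs
∑-++ []       vs = sym (ℤ.+-identityˡ _)
∑-++ (u ∷ us) vs = trans (cong (ℤ._+_ u) (∑-++ us vs)) (sym (ℤ.+-assoc u (∑ us) (∑ vs)))

∑-map-++ : ∀ (h : X → ℤ) xs ys →
           ∑ (map h (xs ++ ys)) ≡ ∑ (map h xs) ℤ.+ ∑ (map h ys)
∑-map-++ h xs ys = trans (cong ∑ (map-++ h xs ys)) (∑-++ (map h xs) (map h ys))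

∑-map-∘ : ∀ (h : Y → ℤ) (k : X → Y) xs → ∑ (map h (map k xs)) ≡ ∑ (map (h ∘ k) xs)
∑-map-∘ h k xs = cong ∑ (sym (map-∘ xs))

∑-concatMap : ∀ (h : Y → ℤ) (k : X → List Y) xs →
              ∑ (map h (concatMap k xs)) ≡ ∑ (map (λ y → ∑ (map h (k y))) xs)
∑-concatMap h k []       = refl
∑-concatMap h k (y ∷ ys) =
  trans (∑-map-++ h (k y) _) (cong (ℤ._+_ (∑ (map h (k y)))) (∑-concatMap h k ys))

∑-cartesianProductWith : ∀ (h : Z → ℤ) (k : X → Y → Z) xs ys →
  ∑ (map h (cartesianProductWith k xs ys)) ≡ ∑ (map (λ y → ∑ (map (h ∘ k y) ys)) xs)
∑-cartesianProductWith h k []       ys = refl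
∑-cartesianProductWith h k (z ∷ zs) ys =
  trans (∑-map-++ h (map (k z) ys) _)
        (cong₂ ℤ._+_ (∑-map-∘ h (k z) ys) (∑-cartesianProductWith h k zs ys))

∑-*ˡ : ∀ c (h : X → ℤ) xs → ∑ (map (λ y → c ℤ.* h y) xs) ≡ c ℤ.* ∑ (map h xs)
∑-*ˡ c h []       = sym (ℤ.*-zeroʳ c)
∑-*ˡ c h (y ∷ ys) =
  trans (cong (ℤ._+_ (c ℤ.* h y)) (∑-*ˡ c h ys)) (sym (ℤ.*-distribˡ-+ c (h y) _))

∑-*ʳ : ∀ c (h : X → ℤ) xs → ∑ (map (λ y → h y ℤ.* c) xs) ≡ ∑ (map h xs) ℤ.* c
∑-*ʳ c h []       = refl
∑-*ʳ c h (y ∷ ys) =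
  trans (cong (ℤ._+_ (h y ℤ.* c)) (∑-*ʳ c h ys)) (sym (ℤ.*-distribʳ-+ c (h y) _))

∑-* : ∀ (h : X → ℤ) (k : Y → ℤ) xs ys →
      ∑ (map (λ y → ∑ (map (λ z → h y ℤ.* k z) ys)) xs) ≡ ∑ (map h xs) ℤ.* ∑ (map k ys)
∑-* h k xs ys =
  trans (∑-cong (λ y → ∑-*ˡ (h y) k ys) xs) (∑-*ʳ (∑ (map k ys)) h xs)

-- Turns a count into a sum of indicators, so that counting becomes a special case of summing
-- weights.
length-filter : ∀ {P : Pred X 0ℓ} (P? : Decidable P) xs →
                + length (filter P? xs) ≡ ∑ (map (λ y → if does (P? y) then 1ℤ else 0ℤ) xs)
length-filter P? []       = refl
length-filter P? (y ∷ ys) with does (P? y)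
... | false = trans (length-filter P? ys) (sym (ℤ.+-identityˡ _))
... | true  = cong (ℤ._+_ 1ℤ) (length-filter P? ys)

-- Power series

⊛-cong : ∀ {u u′ v v′} → u ≗ u′ → v ≗ v′ → u ⊛ v ≗ u′ ⊛ v′
⊛-cong u≗u′ v≗v′ n = ∑-cong (λ (i , j , _) → cong₂ ℤ._*_ (u≗u′ i) (v≗v′ j)) (splits n)

^-cong : ∀ {u v} → u ≗ v → ∀ k → u ^ k ≗ v ^ k
^-cong u≗v zero    n = refl
^-cong u≗v (suc k) n = ⊛-cong u≗v (^-cong u≗v k) n

1/1--cong : ∀ {u v} → u ≗ v → 1/1- u ≗ 1/1- v
1/1--cong u≗v n = ∑-applyUpTo-cong (λ k → ^-cong u≗v k n) (suc n)

-- Needed to iterate `Φ`, since `_≈_` is only coefficientwise equality.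
Φ-cong : ∀ {u v} → u ≈ v → Φ u ≈ Φ v
Φ-cong u≈v n = cong₂ ℤ._+_ (u≈v n) (⊛-cong {u = x} (λ _ → refl) (1/1--cong u≈v) n)

-- Convolution sums and the equation for x / (1 - u)

∑-splits : (ℕ → ℕ → ℤ) → ℕ → ℤ
∑-splits h n = ∑ (map (λ (i , j , _) → h i j) (splits n))

∑-splits-cons : ∀ h n → ∑-splits h (suc n) ≡ h 0 (suc n) ℤ.+ ∑-splits (h ∘ suc) n
∑-splits-cons h n = cong (ℤ._+_ (h 0 (suc n))) (∑-map-∘ (λ (i , j , _) → h i j) sucˡ (splits n))

-- `splits` grows at its left end, so its last entry is reached by induction. An arbitrary `h` lets
-- the hypothesis apply to `h ∘ suc`.
∑-splits-snoc : ∀ h n → ∑-splits h (suc n) ≡ ∑-splits (λ i → h i ∘ suc) n ℤ.+ h (suc n) 0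
∑-splits-snoc h zero    = lemma (h 0 1) (h 1 0)
  where
  lemma : ∀ p q → p ℤ.+ (q ℤ.+ 0ℤ) ≡ (p ℤ.+ 0ℤ) ℤ.+ q
  lemma = solve-∀
∑-splits-snoc h (suc n) = begin
  ∑-splits h (suc (suc n))
    ≡⟨ ∑-splits-cons h (suc n) ⟩
  p ℤ.+ ∑-splits (h ∘ suc) (suc n)
    ≡⟨ cong (ℤ._+_ p) (∑-splits-snoc (h ∘ suc) n) ⟩
  p ℤ.+ (∑-splits (λ i → h (suc i) ∘ suc) n ℤ.+ q)
    ≡⟨ sym (ℤ.+-assoc p _ q) ⟩
  p ℤ.+ ∑-splits (λ i → h (suc i) ∘ suc) n ℤ.+ q
    ≡⟨ cong (ℤ._+ q) (sym (∑-splits-cons (λ i → h i ∘ suc) n)) ⟩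
  ∑-splits (λ i → h i ∘ suc) (suc n) ℤ.+ q ∎
  where
  p q : ℤ
  p = h 0 (suc (suc n))
  q = h (suc (suc n)) 0

⊛-shift : ∀ u v → v 0 ≡ 0ℤ → ∀ n → (u ⊛ v) (suc n) ≡ (u ⊛ (v ∘ suc)) n
⊛-shift u v v₀ n = begin
  (u ⊛ v) (suc n)
    ≡⟨ ∑-splits-snoc (λ i j → u i ℤ.* v j) n ⟩
  (u ⊛ (v ∘ suc)) n ℤ.+ u (suc n) ℤ.* v 0
    ≡⟨ cong (λ r → (u ⊛ (v ∘ suc)) n ℤ.+ u (suc n) ℤ.* r) v₀ ⟩
  (u ⊛ (v ∘ suc)) n ℤ.+ u (suc n) ℤ.* 0ℤ
    ≡⟨ cong (ℤ._+_ ((u ⊛ (v ∘ suc)) n)) (ℤ.*-zeroʳ (u (suc n))) ⟩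
  (u ⊛ (v ∘ suc)) n ℤ.+ 0ℤ
    ≡⟨ ℤ.+-identityʳ _ ⟩
  (u ⊛ (v ∘ suc)) n ∎

x-⊛-suc : ∀ u n → (x ⊛ u) (suc n) ≡ u n
x-⊛-suc u n = begin
  (x ⊛ u) (suc n)
    ≡⟨ ∑-splits-cons (λ i j → x i ℤ.* u j) n ⟩
  0ℤ ℤ.* u (suc n) ℤ.+ ((x ∘ suc) ⊛ u) n
    ≡⟨ cong (ℤ._+ ((x ∘ suc) ⊛ u) n) (ℤ.*-zeroˡ (u (suc n))) ⟩
  0ℤ ℤ.+ ((x ∘ suc) ⊛ u) n
    ≡⟨ ℤ.+-identityˡ _ ⟩
  ((x ∘ suc) ⊛ u) n
    ≡⟨ ⊛-cong x∘suc (λ _ → refl) n ⟩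
  (one ⊛ u) n
    ≡⟨ one-⊛ u n ⟩
  u n ∎
  where
  x∘suc : x ∘ suc ≗ one
  x∘suc zero    = refl
  x∘suc (suc _) = refl

1/1--unfold : ∀ u → u 0 ≡ 0ℤ → 1/1- u ≗ one ⊕ u ⊛ (1/1- u)
1/1--unfold u u₀ n = begin
  v n
    ≡⟨ lemma (v n) ((u ⊛ v) n) ⟩
  v n ℤ.- (u ⊛ v) n ℤ.+ (u ⊛ v) n
    ≡⟨ cong (λ r → r ℤ.- (u ⊛ v) n ℤ.+ (u ⊛ v) n) (sym (one-⊛ v n)) ⟩
  (one ⊛ v) n ℤ.- (u ⊛ v) n ℤ.+ (u ⊛ v) n
    ≡⟨ cong (ℤ._+ (u ⊛ v) n) (sym (⊛-distribʳ-⊖ one u v n)) ⟩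
  ((one ⊖ u) ⊛ v) n ℤ.+ (u ⊛ v) n
    ≡⟨ cong (ℤ._+ (u ⊛ v) n) (1/1--inverse u u₀ n) ⟩
  one n ℤ.+ (u ⊛ v) n ∎
  where
  v : PowerSeries
  v = 1/1- u
  lemma : ∀ p q → p ≡ p ℤ.- q ℤ.+ q
  lemma = solve-∀

-- This is 1/(1 - u) = 1 + u/(1 - u) multiplied by x. Multiplication by x is done as an index shift,
-- which avoids associativity and commutativity of `_⊛_`.
x/1--unfold : ∀ u → u 0 ≡ 0ℤ → x ⊛ (1/1- u) ≗ x ⊕ u ⊛ (x ⊛ (1/1- u))
x/1--unfold u u₀ zero rewrite u₀ = refl
x/1--unfold u u₀ (suc n) = begin
  (x ⊛ v) (suc n)
    ≡⟨ x-⊛-suc v n ⟩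
  v n
    ≡⟨ 1/1--unfold u u₀ n ⟩
  one n ℤ.+ (u ⊛ v) n
    ≡⟨ cong₂ ℤ._+_ (one≡x n) (⊛-cong {u = u} (λ _ → refl) (sym ∘ x-⊛-suc v) n) ⟩
  x (suc n) ℤ.+ (u ⊛ ((x ⊛ v) ∘ suc)) n
    ≡⟨ cong (ℤ._+_ (x (suc n))) (sym (⊛-shift u (x ⊛ v) refl n)) ⟩
  x (suc n) ℤ.+ (u ⊛ (x ⊛ v)) (suc n) ∎
  where
  v : PowerSeries
  v = 1/1- u
  one≡x : ∀ m → one m ≡ x (suc m)
  one≡x zero    = refl
  one≡x (suc _) = refl

-- As `u` has no constant term, the n-th coefficient of `u ⊛ v` depends only on earlier coefficients
-- of `v`, so the equation determines `v` recursively.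
fixpoint-unique : ∀ c u → u 0 ≡ 0ℤ → ∀ {v w} → v ≗ c ⊕ u ⊛ v → w ≗ c ⊕ u ⊛ w → v ≗ w
fixpoint-unique c u u₀ {v} {w} v-fix w-fix = <-rec _ λ n ih → begin
  v n                ≡⟨ v-fix n ⟩
  c n ℤ.+ (u ⊛ v) n  ≡⟨ cong (ℤ._+_ (c n)) (∑-cong (term n ih) (splits n)) ⟩
  c n ℤ.+ (u ⊛ w) n  ≡⟨ sym (w-fix n) ⟩
  w n                ∎
  where
  term : ∀ n → (∀ {m} → m ℕ.< n → v m ≡ w m) →
         ∀ ((i , j , _) : Split n) → u i ℤ.* v j ≡ u i ℤ.* w j
  -- Here j = n, out of reach of the induction hypothesis, but the factor `u 0` kills both sides.
  term n ih (zero  , j , _)    rewrite u₀ = trans (ℤ.*-zeroˡ (v j)) (sym (ℤ.*-zeroˡ (w j)))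
  term n ih (suc i , j , refl) = cong (u (suc i) ℤ.*_) (ih (s≤s (ℕ.m≤n+m j i)))

-- Splitting a bracketing at its root

-- Agreement below `n` suffices: a split with an empty side contributes nothing, and in any other
-- split both sides are smaller than `n`.
combine-cong : ∀ {bs cs : ∀ k → List (Bracketing k)} {n} →
               bs 0 ≡ [] → cs 0 ≡ [] → (∀ k → k ℕ.< n → bs k ≡ cs k) →
               ∀ (p : Split n) → combine bs p ≡ combine cs p
combine-cong b₀ c₀ eq (zero  , j     , refl) rewrite b₀ | c₀ = refl
combine-cong {bs} {cs} b₀ c₀ eq (suc i , zero  , refl) rewrite b₀ | c₀ =
  trans (cartesianProductWith-zeroʳ _⇒_ (bs (suc i)))
        (sym (cartesianProductWith-zeroʳ _⇒_ (cs (suc i))))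
combine-cong b₀ c₀ eq (suc i , suc j , refl) =
  cong₂ (cartesianProductWith _⇒_)
    (eq (suc i) (ℕ.m<m+n (suc i) (s≤s z≤n)))
    (eq (suc j) (ℕ.m<n+m (suc j) (s≤s z≤n)))

bracketings≤-0 : ∀ d → bracketings≤ d 0 ≡ []
bracketings≤-0 zero    = refl
bracketings≤-0 (suc d) rewrite bracketings≤-0 d = refl

bracketings≤-stable : ∀ d e n → n ℕ.≤ d → n ℕ.≤ e → bracketings≤ d n ≡ bracketings≤ e n
bracketings≤-stable d       e       zero    _         _         =
  trans (bracketings≤-0 d) (sym (bracketings≤-0 e))
bracketings≤-stable (suc d) (suc e) (suc n) (s≤s n≤d) (s≤s n≤e) =
  cong (leaves (suc n) ++_)
    (concatMap-cong
      (combine-cong (bracketings≤-0 d) (bracketings≤-0 e)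
        (λ where k (s≤s k≤n) → bracketings≤-stable d e k (ℕ.≤-trans k≤n n≤d) (ℕ.≤-trans k≤n n≤e)))
      (splits (suc n)))

-- Stability in the bound removes it from the recursion: the subtrees are again drawn from
-- `bracketings` itself.
bracketings-unfold : ∀ n →
  bracketings n ≡ leaves n ++ concatMap (combine bracketings) (splits n)
bracketings-unfold zero    = refl
bracketings-unfold (suc n) =
  cong (leaves (suc n) ++_)
    (concatMap-cong
      (combine-cong (bracketings≤-0 n) refl
        -- Unfolding leaves the bound `n` on the subtrees, whereas `bracketings k` uses the bound
        -- `k`.
        (λ where k (s≤s k≤n) → bracketings≤-stable n k k k≤n ℕ.≤-refl))
      (splits (suc n)))

-- The first `m` and the last `n` variables are valued independently. In the induction on `m`, each
-- first value `p` is absorbed into `h`.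
∑-valuations-+ : ∀ m n (h : Valuation m → ℤ) (k : Valuation n → ℤ) →
  ∑ (map (λ ν → h (take m ν) ℤ.* k (drop m ν)) (valuations (m ℕ.+ n))) ≡
  ∑ (map h (valuations m)) ℤ.* ∑ (map k (valuations n))
∑-valuations-+ zero    n h k =
  trans (∑-*ˡ (h []) k (valuations n))
        (cong (ℤ._* ∑ (map k (valuations n))) (sym (ℤ.+-identityʳ (h []))))
∑-valuations-+ (suc m) n h k = begin
  ∑ (map (λ ν → h (take (suc m) ν) ℤ.* k (drop (suc m) ν)) (valuations (suc m ℕ.+ n)))
    ≡⟨ ∑-cartesianProductWith (λ ν → h (take (suc m) ν) ℤ.* k (drop (suc m) ν)) _∷_ (allFin 4) (valuations (m ℕ.+ n)) ⟩
  ∑ (map (λ p → ∑ (map (λ ν → h (p ∷ take m ν) ℤ.* k (drop m ν)) (valuations (m ℕ.+ n)))) (allFin 4))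
    ≡⟨ ∑-cong (λ p → ∑-valuations-+ m n (h ∘ (p ∷_)) k) (allFin 4) ⟩
  ∑ (map (λ p → ∑ (map (h ∘ (p ∷_)) (valuations m)) ℤ.* ∑ (map k (valuations n))) (allFin 4))
    ≡⟨ ∑-*ʳ (∑ (map k (valuations n)))
         (λ p → ∑ (map (h ∘ (p ∷_)) (valuations m))) (allFin 4) ⟩
  ∑ (map (λ p → ∑ (map (h ∘ (p ∷_)) (valuations m))) (allFin 4)) ℤ.* ∑ (map k (valuations n))
    ≡⟨ cong (ℤ._* ∑ (map k (valuations n)))
         (sym (∑-cartesianProductWith h _∷_ (allFin 4) (valuations m))) ⟩
  ∑ (map h (valuations (suc m))) ℤ.* ∑ (map k (valuations n)) ∎

-- Weighted counts

Weight : Set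
Weight = V₄ → ℤ

weight : Weight → ∀ {n} → Bracketing n → ℤ
weight φ {n} s = ∑ (map (φ ∘ eval s) (valuations n))

W : Weight → PowerSeries
W φ n = ∑ (map (weight φ) (bracketings n))

infixl 6 _∔_
_∔_ : Weight → Weight → Weight
(φ ∔ ψ) p = φ p ℤ.+ ψ p

W-∔ : ∀ φ ψ → W (φ ∔ ψ) ≗ W φ ⊕ W ψ
W-∔ φ ψ n =
  trans (∑-cong (λ s → ∑-map-+ (φ ∘ eval s) (ψ ∘ eval s) (valuations n)) (bracketings n))
        (∑-map-+ (weight φ) (weight ψ) (bracketings n))

W-leaves : ∀ φ → ∑ (map φ (allFin 4)) ≡ 1ℤ → ∀ n → ∑ (map (weight φ) (leaves n)) ≡ x n
W-leaves φ φ-sum 0             = refl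
W-leaves φ φ-sum 1             = trans (ℤ.+-identityʳ _) φ-sum
W-leaves φ φ-sum (suc (suc _)) = refl

module _ (φ χ : Weight) (φ-⇒ : ∀ p q → φ (p ⇒G q) ≡ χ p ℤ.* φ q) where

  -- The two subtrees share no variables, so the pointwise factorization at the root survives
  -- summation over valuations.
  weight-⇒ : ∀ {m n} (r : Bracketing m) (s : Bracketing n) →
             weight φ (r ⇒ s) ≡ weight χ r ℤ.* weight φ s
  weight-⇒ {m} {n} r s =
    trans (∑-cong (λ ν → φ-⇒ (eval r (take m ν)) (eval s (drop m ν))) (valuations (m ℕ.+ n)))
          (∑-valuations-+ m n (χ ∘ eval r) (φ ∘ eval s))

  W-combine : ∀ {n} ((i , j , e) : Split n) →
              ∑ (map (weight φ) (combine bracketings (i , j , e))) ≡ W χ i ℤ.* W φ j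
  W-combine (i , j , refl) = begin
    ∑ (map (weight φ) (cartesianProductWith _⇒_ (bracketings i) (bracketings j)))
      ≡⟨ ∑-cartesianProductWith (weight φ) _⇒_ (bracketings i) (bracketings j) ⟩
    ∑ (map (λ r → ∑ (map (λ s → weight φ (r ⇒ s)) (bracketings j))) (bracketings i))
      ≡⟨ ∑-cong (λ r → ∑-cong (weight-⇒ r) (bracketings j)) (bracketings i) ⟩
    ∑ (map (λ r → ∑ (map (λ s → weight χ r ℤ.* weight φ s) (bracketings j))) (bracketings i))
      ≡⟨ ∑-* (weight χ) (weight φ) (bracketings i) (bracketings j) ⟩
    W χ i ℤ.* W φ j ∎

  W-fixpoint : ∑ (map φ (allFin 4)) ≡ 1ℤ → W φ ≗ x ⊕ W χ ⊛ W φ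
  W-fixpoint φ-sum n = begin
    W φ n
      ≡⟨ cong (∑ ∘ map (weight φ)) (bracketings-unfold n) ⟩
    ∑ (map (weight φ) (leaves n ++ concatMap (combine bracketings) (splits n)))
      ≡⟨ ∑-map-++ (weight φ) (leaves n) _ ⟩
    ∑ (map (weight φ) (leaves n)) ℤ.+ ∑ (map (weight φ) (concatMap (combine bracketings) (splits n)))
      ≡⟨ cong₂ ℤ._+_ (W-leaves φ φ-sum n)
           (trans (∑-concatMap (weight φ) (combine bracketings) (splits n))
                  (∑-cong W-combine (splits n))) ⟩
    x n ℤ.+ (W χ ⊛ W φ) n ∎

  -- Both series solve v = x + u v. Keeping `u` apart from `W χ` lets a tail sum be used directly.
  W≗x/1- : ∑ (map φ (allFin 4)) ≡ 1ℤ → ∀ {u} → u 0 ≡ 0ℤ → W χ ≗ u → W φ ≗ x ⊛ (1/1- u)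
  W≗x/1- φ-sum {u} u₀ Wχ≗u = fixpoint-unique x u u₀
    (λ n → trans (W-fixpoint φ-sum n) (cong (ℤ._+_ (x n)) (⊛-cong Wχ≗u (λ _ → refl) n)))
    (x/1--unfold u u₀)

-- Truth values

δ : V₄ → Weight
δ v p = if does (p ≟ v) then 1ℤ else 0ℤ

#value≡W : ∀ v n → + #value v n ≡ W (δ v) n
#value≡W v n =
  trans (length-filter (λ (s , ν) → eval s ν ≟ v) (interpretations n))
        (∑-cartesianProductWith _ _,_ (bracketings n) (valuations n))

W-∔-≗ : ∀ {φ ψ u v} → W φ ≗ u → W ψ ≗ v → W (φ ∔ ψ) ≗ u ⊕ v
W-∔-≗ {φ} {ψ} p q n = trans (W-∔ φ ψ n) (cong₂ ℤ._+_ (p n) (q n))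

WT : W (δ 𝟏) ≗ coeff T
WT = sym ∘ #value≡W 𝟏

WB : W (δ 𝒃) ≗ coeff B
WB = sym ∘ #value≡W 𝒃

WA : W (δ 𝒂) ≗ coeff A
WA = sym ∘ #value≡W 𝒂

B≗ : coeff B ≗ x ⊛ (1/1- coeff H₃)
B≗ n = trans (#value≡W 𝒃 n) (W≗x/1- (δ 𝒃) (δ 𝟏) factor refl refl WT n)
  where
  factor : ∀ p q → δ 𝒃 (p ⇒G q) ≡ δ 𝟏 p ℤ.* δ 𝒃 q
  -- Decided by evaluation at all sixteen pairs of truth values.
  factor = from-yes (all? λ p → all? λ q → δ 𝒃 (p ⇒G q) ℤ.≟ δ 𝟏 p ℤ.* δ 𝒃 q)

A≗ : coeff A ≗ x ⊛ (1/1- coeff H₂)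
A≗ n = trans (#value≡W 𝒂 n)
  (W≗x/1- (δ 𝒂) (δ 𝒃 ∔ δ 𝟏) factor refl refl (W-∔-≗ {δ 𝒃} {δ 𝟏} WB WT) n)
  where
  factor : ∀ p q → δ 𝒂 (p ⇒G q) ≡ (δ 𝒃 ∔ δ 𝟏) p ℤ.* δ 𝒂 q
  factor = from-yes (all? λ p → all? λ q → δ 𝒂 (p ⇒G q) ℤ.≟ (δ 𝒃 ∔ δ 𝟏) p ℤ.* δ 𝒂 q)

F≗ : coeff F ≗ x ⊛ (1/1- coeff H₁)
F≗ n = trans (#value≡W 𝟎 n)
  -- The indicators are summed in the same order and association as the series in `H₁`. The two
  -- `refl` give the total weight 1 and the zero constant term.
  (W≗x/1- (δ 𝟎) (δ 𝒂 ∔ δ 𝒃 ∔ δ 𝟏) factor refl refl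
    (W-∔-≗ {δ 𝒂 ∔ δ 𝒃} {δ 𝟏} (W-∔-≗ {δ 𝒂} {δ 𝒃} WA WB) WT) n)
  where
  factor : ∀ p q → δ 𝟎 (p ⇒G q) ≡ (δ 𝒂 ∔ δ 𝒃 ∔ δ 𝟏) p ℤ.* δ 𝟎 q
  factor = from-yes (all? λ p → all? λ q → δ 𝟎 (p ⇒G q) ℤ.≟ (δ 𝒂 ∔ δ 𝒃 ∔ δ 𝟏) p ℤ.* δ 𝟎 q)

-- The tail-sum recursion and its threefold iterate

H₂≈ΦH₃ : H₂ ≈ Φ H₃
H₂≈ΦH₃ n = trans (ℤ.+-comm (coeff B n) (coeff T n)) (cong (ℤ._+_ (coeff T n)) (B≗ n))

H₁≈ΦH₂ : H₁ ≈ Φ H₂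
H₁≈ΦH₂ n = trans (lemma (coeff A n) (coeff B n) (coeff T n)) (cong (ℤ._+_ (coeff H₂ n)) (A≗ n))
  where
  lemma : ∀ p q r → p ℤ.+ q ℤ.+ r ≡ q ℤ.+ r ℤ.+ p
  lemma = solve-∀

H₀≈ΦH₁ : H₀ ≈ Φ H₁
H₀≈ΦH₁ n = trans (lemma (coeff F n) (coeff A n) (coeff B n) (coeff T n))
                 (cong (ℤ._+_ (coeff H₁ n)) (F≗ n))
  where
  lemma : ∀ p q r s → p ℤ.+ q ℤ.+ r ℤ.+ s ≡ q ℤ.+ r ℤ.+ s ℤ.+ p
  lemma = solve-∀

G≈Φ³T : G ≈ iterate Φ T 3
G≈Φ³T n = begin
  -- The chain may start at `H₀`: its coefficients compute to those of `G`, because integer addition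
  -- of naturals reduces to addition in ℕ.
  coeff H₀ n              ≡⟨ H₀≈ΦH₁ n ⟩
  coeff (Φ H₁) n          ≡⟨ Φ-cong {H₁} {Φ H₂} H₁≈ΦH₂ n ⟩
  coeff (Φ (Φ H₂)) n      ≡⟨ Φ-cong {Φ H₂} {Φ (Φ T)} (Φ-cong {H₂} {Φ T} H₂≈ΦH₃) n ⟩
  coeff (Φ (Φ (Φ T))) n   ∎

proposition2 : (H₀ ≈ G) × (H₂ ≈ Φ H₃) × (H₁ ≈ Φ H₂) × (H₀ ≈ Φ H₁) × (G ≈ iterate Φ T 3)
proposition2 = (λ _ → refl) , H₂≈ΦH₃ , H₁≈ΦH₂ , H₀≈ΦH₁ , G≈Φ³T
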